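{- Let $G$ be a connected graph and let $s,t\in V(G)$. Then $d_G(s,t)=1$ if and only if $\lambda_G(s,t)=1$.
   Context: Rendezvous game with adversaries. Let $G$ be a finite, simple, undirected, connected graph, let $s,t\in V(G)$ and let $k\ge 1$ be an integer. Two players play: Facilitator, who controls two agents $R$ and $J$ initially placed on $s$ and $t$ respectively, and Divider, who controls $k$ agents $D_1,\dots,D_k$ which Divider initially places on vertices of $V(G)\setminus\{s,t\}$ of his choice (several agents may share a vertex). After the initial placement the players alternate moves, Facilitator moving first. In a move, the player moves each of his agents to an adjacent vertex or leaves it where it is; no agent may be moved to a vertex currently occupied by an agent of the opponent. Both players have full information. Facilitator wins if at some moment $R$ and $J$ occupy the same vertex; Divider wins if this never happens. $d_G(s,t)$ (the $(s,t)$-dividing number) is the minimum $k$ such that Divider with $k$ agents has a winning strategy on $G$ against Facilitator starting from $s$ and $t$; $d_G(s,t)=+\infty$ if $s=t$ or $s,t$ are adjacent. $\lambda_G(s,t)$ is the minimum size of a set $S\subseteq V(G)\setminus\{s,t\}$ such that $s$ and $t$ lie in different connected components of $G-S$; $\lambda_G(s,t)=+\infty$ if $s=t$ or $s,t$ are adjacent. -}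

module Defs where

open import Data.Nat.Base using (ℕ; _≤_)
open import Data.Fin.Base using (Fin)
open import Data.Fin.Subset as Subset using (Subset; ∣_∣)
open import Data.Product.Base using (Σ; ∃; _×_; _,_; proj₁)
open import Data.Sum.Base using (_⊎_)
open import Data.Unit.Base using (⊤)
open import Data.Vec.Base using (Vec; []; _∷_)
open import Data.Vec.Membership.Propositional using (_∉_)
open import Data.Vec.Relation.Unary.All using (All)
open import Data.Vec.Relation.Binary.Pointwise.Inductive using (Pointwise)
open import Level using (0ℓ)
open import Relation.Binary.Core using (Rel)
open import Relation.Binary.Definitions using (Symmetric; Irreflexive; Decidable)
open import Relation.Binary.Construct.Closure.ReflexiveTransitive using (Star)
open import Relation.Binary.PropositionalEquality.Core using (_≡_; _≢_)
open import Relation.Nullary.Negation.Core using (¬_)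
open import Relation.Nullary.Construct.Add.Supremum using (_⁺; [_]; ⊤⁺)
open import Relation.Unary using (Pred)

record Graph (n : ℕ) : Set₁ where
  infix 4 _~_ _~?_
  field
    _~_      : Rel (Fin n) 0ℓ
    ~-sym    : Symmetric _~_
    ~-irrefl : Irreflexive _≡_ _~_
    _~?_     : Decidable _~_

-- m is the minimum of P in ℕ ∪ {+∞}, where min ∅ = +∞.
IsMin : Pred ℕ 0ℓ → ℕ ⁺ → Set
IsMin P [ m ] = P m × (∀ k → P k → m ≤ k)
IsMin P ⊤⁺    = ∀ k → ¬ P k

module _ {n : ℕ} (G : Graph n) where

  open Graph G

  private
    V : Set
    V = Fin n

  Connected : Set
  Connected = ∀ u v → Star _~_ u v

  EqualOrAdjacent : V → V → Set
  EqualOrAdjacent s t = s ≡ t ⊎ s ~ t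

  -- Adjacency in G − S.
  AdjOutside : Subset n → Rel V 0ℓ
  AdjOutside S u v = u Subset.∉ S × v Subset.∉ S × u ~ v

  Separates : V → V → Subset n → Set
  Separates s t S =
    s Subset.∉ S × t Subset.∉ S × ¬ Star (AdjOutside S) s t

  -- IsSeparationNumber s t x says that λ_G(s,t) = x.
  IsSeparationNumber : V → V → ℕ ⁺ → Set
  IsSeparationNumber s t x =
      (EqualOrAdjacent s t × x ≡ ⊤⁺)
    ⊎ (¬ EqualOrAdjacent s t
      × IsMin (λ k → Σ (Subset n) λ S → ∣ S ∣ ≡ k × Separates s t S) x)

  -- An agent at u may end at v, the opponent's agents being at occ.
  Step : ∀ {m} → Vec V m → Rel V 0ℓ
  Step occ u v = v ≡ u ⊎ (u ~ v × v ∉ occ)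

  data Player : Set where
    facilitator divider : Player

  module Game (s t : V) {k : ℕ} (D₀ : Vec V k) where

    -- Play p r j D: a finite initial part of a play started with Divider's
    -- agents on D₀; it ends with p to move, R on r, J on j and Divider's
    -- agents on D.
    data Play : Player → V → V → Vec V k → Set where
      start : Play facilitator s t D₀
      fmove : ∀ {r j r′ j′ D} → Play facilitator r j D →
              Step D r r′ → Step D j j′ →
              Play divider r′ j′ D
      dmove : ∀ {r j D D′} → Play divider r j D →
              Pointwise (Step (r ∷ j ∷ [])) D D′ →
              Play facilitator r j D′

    -- Divider's response may depend on the whole play so far.
    Strategy : Set
    Strategy = ∀ {r j D} → Play divider r j D →
               Σ (Vec V k) λ D′ → Pointwise (Step (r ∷ j ∷ [])) D D′

    Follows : Strategy → ∀ {p r j D} → Play p r j D → Set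
    Follows σ start                 = ⊤
    Follows σ (fmove h _ _)         = Follows σ h
    Follows σ (dmove {D′ = D′} h _) = Follows σ h × D′ ≡ proj₁ (σ h)

    -- R and J never meet: an infinite play avoids a meeting exactly when all
    -- of its finite initial parts do.
    Winning : Strategy → Set
    Winning σ = ∀ {p r j D} (h : Play p r j D) → Follows σ h → r ≢ j

  DividerWins : V → V → ℕ → Set
  DividerWins s t k =
    Σ (Vec V k) λ D₀ →
      All (λ v → v ≢ s × v ≢ t) D₀ × ∃ (Game.Winning s t D₀)

  -- IsDividingNumber s t x says that d_G(s,t) = x.
  IsDividingNumber : V → V → ℕ ⁺ → Set
  IsDividingNumber s t x =
      (EqualOrAdjacent s t × x ≡ ⊤⁺)
    ⊎ (¬ EqualOrAdjacent s t
      × IsMin (λ k → 1 ≤ k × DividerWins s t k) x)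

{-# OPTIONS --safe #-}
module Submission where

-- If v separates s from t, Divider simply stays on v. Otherwise s and t lie on
-- a common cycle, and Facilitator beats a single agent from any two vertices
-- of a cycle, by induction on its length. R and J run towards each other along
-- one arc B. The agent must enter B before they meet; let e be its route since
-- it last touched the other arc A, at q say. Since then R and J have moved away
-- from q at every step, so e is shorter than both cycle paths from q to its entry
-- point z: the theta graph formed by the cycle and e has two shorter cycles through
-- e, one containing R and the other J. The agent cannot keep R from the cycle of J
-- and also J from that of R, so Facilitator brings both onto the same shorter cycle.

open import Defs
open import Data.Nat.Base using (ℕ; zero; suc; _+_; _≤_; _<_; z≤n; s≤s; s≤s⁻¹)
open import Data.Nat.Properties hiding (_≟_)
open import Data.Nat.Solver using (module +-*-Solver)
open +-*-Solver using (_:+_; _:=_; con) renaming (solve to solveℕ)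
open import Data.Fin.Base as Fin using (Fin)
open import Data.Fin.Properties using (_≟_; any?)
open import Data.Fin.Subset as Subset using (Subset; ⁅_⁆; ∣_∣; inside; outside)
open import Data.Fin.Subset.Properties
  using (x∈⁅x⁆; x≢y⇒x∉⁅y⁆; x∉⁅y⁆⇒x≢y; ∣⁅x⁆∣≡1; ∉⊥)
  renaming (_∈?_ to _∈ₛ?_)
open import Data.List.Base using (List; []; _∷_; _++_; length; allFin) renaming ([_] to ⟨_⟩)
open import Data.List.Properties using (length-++; length-++-≤ˡ; length-++-≤ʳ; ++-identityʳ)
open import Data.List.Membership.Propositional using (_∈_; _∉_)
open import Data.List.Membership.Propositional.Properties
  using (∈-++⁺ˡ; ∈-++⁺ʳ; ∈-++⁻; ∈-∃++; ∈-allFin)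
open import Data.List.Relation.Unary.Any using (here; there)
open import Data.List.Relation.Unary.All using (lookup; tabulate; [])
open import Data.List.Relation.Unary.AllPairs using ([]; _∷_)
open import Data.List.Relation.Unary.Unique.Propositional using (Unique)
import Data.List.Relation.Unary.Unique.Propositional.Properties as Unique
open import Data.List.Relation.Binary.Permutation.Propositional
  using (_↭_; refl; prep; ↭-refl; ↭-sym; ↭-trans; ↭⇒↭ₛ)
open import Data.List.Relation.Binary.Permutation.Propositional.Properties
  using (++⁺ʳ; ++-comm; ∷↭∷ʳ; ∈-resp-↭; ↭-length; ++-commutativeMonoid)
open import Data.Vec.Base using ([]; _∷_)
open import Data.Vec.Relation.Unary.All using ([]; _∷_)
open import Data.Vec.Relation.Unary.Any using (here; there)
open import Data.Vec.Relation.Binary.Pointwise.Inductive as Pointwise using (Pointwise; []; _∷_)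
open import Data.Product.Base using (Σ; ∃; ∃₂; _×_; _,_; proj₁; proj₂; -,_)
open import Data.Sum.Base using (_⊎_; inj₁; inj₂)
open import Data.Empty using (⊥; ⊥-elim)
open import Function.Base using (_∘_; id)
open import Function.Bundles using (_⇔_; mk⇔)
open import Level using (0ℓ)
open import Relation.Binary.Core using (Rel)
open import Relation.Binary.Definitions using (Decidable)
open import Relation.Binary.Construct.Closure.ReflexiveTransitive as Star
  using (Star; ε; _◅_; _◅◅_)
open import Relation.Binary.PropositionalEquality
  using (_≡_; _≢_; refl; sym; cong; subst; ≢-sym; setoid)
open import Relation.Nullary using (¬_; yes; no)
open import Relation.Nullary.Decidable
  using (¬?; map′; _×-dec_; _⊎-dec_; decidable-stable)
open import Relation.Nullary.Construct.Add.Supremum using ([_])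
import Algebra.Solver.CommutativeMonoid as CommutativeMonoidSolver
import Data.List.Relation.Binary.Permutation.Setoid.Properties as PermutationSetoid
import Data.List.Membership.DecPropositional as DecMembership

-- Decidability of reachability, by Warshall's recursion.

module _ {n : ℕ} {R : Rel (Fin n) 0ℓ} (R? : Decidable R) where

  -- Some walk from u to v has all its inner vertices in L.
  Via : List (Fin n) → Rel (Fin n) 0ℓ
  Via []      u v = u ≡ v ⊎ R u v
  Via (x ∷ L) u v = Via L u v ⊎ (Via L u x × Via L x v)

  via? : ∀ L → Decidable (Via L)
  via? []      u v = u ≟ v ⊎-dec R? u v
  via? (x ∷ L) u v = via? L u v ⊎-dec (via? L u x ×-dec via? L x v)

  Via⇒Star : ∀ L {u v} → Via L u v → Star R u v
  Via⇒Star []      (inj₁ refl)    = ε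
  Via⇒Star []      (inj₂ e)       = e ◅ ε
  Via⇒Star (x ∷ L) (inj₁ p)       = Via⇒Star L p
  Via⇒Star (x ∷ L) (inj₂ (p , q)) = Via⇒Star L p ◅◅ Via⇒Star L q

  Via-direct : ∀ L {u v} → u ≡ v ⊎ R u v → Via L u v
  Via-direct []      e = e
  Via-direct (x ∷ L) e = inj₁ (Via-direct L e)

  -- Induction on the position of `x` in `L`. At the head, each walk is cut at a visit of `x`, after
  -- which its inner vertices lie in the rest of the list.
  Via-trans : ∀ L {u x v} → x ∈ L → Via L u x → Via L x v → Via L u v
  Via-trans (x ∷ L) (here refl) p q = inj₂ (toHead p , fromHead q)
    where
    toHead : ∀ {u} → Via (x ∷ L) u x → Via L u x
    toHead (inj₁ p)       = p
    toHead (inj₂ (p , _)) = p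
    fromHead : ∀ {v} → Via (x ∷ L) x v → Via L x v
    fromHead (inj₁ q)       = q
    fromHead (inj₂ (_ , q)) = q
  Via-trans (y ∷ L) (there i) (inj₁ p)        (inj₁ q)        = inj₁ (Via-trans L i p q)
  Via-trans (y ∷ L) (there i) (inj₁ p)        (inj₂ (q , q′)) = inj₂ (Via-trans L i p q , q′)
  Via-trans (y ∷ L) (there i) (inj₂ (p , p′)) (inj₁ q)        = inj₂ (p , Via-trans L i p′ q)
  -- Both walks pass through `y`: the excursion from `y` to `x` and back is dropped.
  Via-trans (y ∷ L) (there i) (inj₂ (p , _))  (inj₂ (_ , q))  = inj₂ (p , q)

  Star⇒Via : ∀ {u v} → Star R u v → Via (allFin n) u v
  Star⇒Via ε       = Via-direct (allFin n) (inj₁ refl)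
  Star⇒Via (e ◅ p) =
    Via-trans (allFin n) (∈-allFin _) (Via-direct (allFin n) (inj₂ e)) (Star⇒Via p)

  star? : Decidable (Star R)
  star? u v = map′ (Via⇒Star (allFin n)) Star⇒Via (via? (allFin n) u v)

-- Subsets with at most one element.

∣p∣≡0⇒p≡⊥ : ∀ {n} (p : Subset n) → ∣ p ∣ ≡ 0 → p ≡ Subset.⊥
∣p∣≡0⇒p≡⊥ []            _  = refl
∣p∣≡0⇒p≡⊥ (outside ∷ p) eq = cong (outside ∷_) (∣p∣≡0⇒p≡⊥ p eq)

∣p∣≡1⇒p≡⁅x⁆ : ∀ {n} (p : Subset n) → ∣ p ∣ ≡ 1 → ∃ λ x → p ≡ ⁅ x ⁆
∣p∣≡1⇒p≡⁅x⁆ (inside ∷ p)  eq = Fin.zero , cong (inside ∷_) (∣p∣≡0⇒p≡⊥ p (suc-injective eq))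
∣p∣≡1⇒p≡⁅x⁆ (outside ∷ p) eq with ∣p∣≡1⇒p≡⁅x⁆ p eq
... | x , refl = Fin.suc x , refl

-- Lists without repetition.

module _ {A : Set} where

  Unique-resp-↭ : {xs ys : List A} → xs ↭ ys → Unique xs → Unique ys
  Unique-resp-↭ p = PermutationSetoid.Unique-resp-↭ (setoid A) (↭⇒↭ₛ p)

  Unique-++⁻ˡ : (xs : List A) {ys : List A} → Unique (xs ++ ys) → Unique xs
  Unique-++⁻ˡ []       _          = []
  Unique-++⁻ˡ (x ∷ xs) (x# ∷ uxs) =
    tabulate (λ i → lookup x# (∈-++⁺ˡ i)) ∷ Unique-++⁻ˡ xs uxs

  Unique-++⁻ʳ : (xs : List A) {ys : List A} → Unique (xs ++ ys) → Unique ys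
  Unique-++⁻ʳ []       u       = u
  Unique-++⁻ʳ (x ∷ xs) (_ ∷ u) = Unique-++⁻ʳ xs u

  Unique-replace : {xs ys : List A} (zs : List A) → xs ↭ ys →
                   Unique (xs ++ zs) → Unique (ys ++ zs)
  Unique-replace zs p = Unique-resp-↭ (++⁺ʳ zs p)

  Unique-∷ : {x : A} {xs : List A} → x ∉ xs → Unique xs → Unique (x ∷ xs)
  Unique-∷ x∉ u = tabulate (λ i x≡ → x∉ (subst (_∈ _) (sym x≡) i)) ∷ u

  Unique⇒≢ : {x y : A} {xs : List A} → Unique (x ∷ y ∷ xs) → x ≢ y
  Unique⇒≢ (x# ∷ _) = lookup x# (here refl)

-- Paths in a graph.

module _ {n : ℕ} (G : Graph n) where

  open Graph G

  private
    V : Set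
    V = Fin n

  open DecMembership (_≟_ {n}) using (_∈?_)
  open CommutativeMonoidSolver (++-commutativeMonoid {A = V}) using (solve; _⊜_; _⊕_)

  -- The list consists of the interior vertices only.
  data Path : V → List V → V → Set where
    edge : ∀ {u v} → u ~ v → Path u [] v
    _∷_  : ∀ {u x xs v} → u ~ x → Path x xs v → Path u (x ∷ xs) v

  join : ∀ {u xs x ys v} → Path u xs x → Path x ys v → Path u (xs ++ x ∷ ys) v
  join (edge e) q = e ∷ q
  join (e ∷ p)  q = e ∷ join p q

  split : ∀ {u x ys v} xs → Path u (xs ++ x ∷ ys) v → Path u xs x × Path x ys v
  split []       (e ∷ q) = edge e , q
  split (_ ∷ xs) (e ∷ p) with split xs p
  ... | p₁ , p₂ = e ∷ p₁ , p₂

  snoc : ∀ {u xs x v} → Path u xs x → x ~ v → Path u (xs ++ ⟨ x ⟩) v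
  snoc p e = join p (edge e)

  reversePath : ∀ {u xs v} → Path u xs v → ∃ λ ys → Path v ys u × ys ↭ xs
  reversePath (edge e) = [] , edge (~-sym e) , refl
  reversePath {xs = x ∷ xs} (e ∷ p) with reversePath p
  ... | ys , q , ys↭ = ys ++ ⟨ x ⟩ , snoc q (~-sym e) ,
        ↭-trans (↭-sym (∷↭∷ʳ x ys)) (prep x ys↭)

  unsnoc : ∀ {u xs v} → Path u xs v →
           (xs ≡ [] × u ~ v) ⊎
           (∃₂ λ ys y → xs ≡ ys ++ ⟨ y ⟩ × Path u ys y × y ~ v)
  unsnoc (edge e) = inj₁ (refl , e)
  unsnoc (e ∷ p) with unsnoc p
  ... | inj₁ (refl , e′) = inj₂ ([] , -, refl , edge e , e′)
  ... | inj₂ (ys , y , refl , q , e′) = inj₂ (_ , y , refl , e ∷ q , e′)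

  -- The game against a single Divider agent.

  Move : V → V → Set
  Move u v = v ≡ u ⊎ u ~ v

  -- Wins r j d: Facilitator, to move, forces a meeting of R on r and J on j
  -- against a single Divider agent on d.
  data Wins : V → V → V → Set where
    meet : ∀ {r d} → Wins r r d
    move : ∀ {r j d} r′ j′ → Move r r′ → Move j j′ → r′ ≢ d → j′ ≢ d →
           (∀ d′ → Move d d′ → d′ ≢ r′ → d′ ≢ j′ → Wins r′ j′ d′) →
           Wins r j d

  Wins-sym : ∀ {r j d} → Wins r j d → Wins j r d
  Wins-sym meet = meet
  Wins-sym (move r′ j′ m m′ ≢r ≢j next) =
    move j′ r′ m′ m ≢j ≢r λ d′ m″ ≢j′ ≢r′ → Wins-sym (next d′ m″ ≢r′ ≢j′)

  moveR : ∀ {r j d} r′ → r ~ r′ → r′ ≢ d → d ≢ j →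
          (∀ d′ → Move d d′ → d′ ≢ r′ → d′ ≢ j → Wins r′ j d′) → Wins r j d
  moveR r′ e r′≢d d≢j = move r′ _ (inj₂ e) (inj₁ refl) r′≢d (≢-sym d≢j)

  moveJ : ∀ {r j d} j′ → j ~ j′ → j′ ≢ d → d ≢ r →
          (∀ d′ → Move d d′ → d′ ≢ r → d′ ≢ j′ → Wins r j′ d′) → Wins r j d
  moveJ j′ e j′≢d d≢r = move _ j′ (inj₁ refl) (inj₂ e) (≢-sym d≢r) j′≢d

  -- Both arcs may be empty: an edge taken twice counts as a cycle, and on it R simply steps onto J.
  record Cycle (r : V) (a : List V) (j : V) (b : List V) : Set where
    constructor cycle
    field
      path₁  : Path r a j
      path₂  : Path r b j
      unique : Unique (r ∷ j ∷ a ++ b)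

  -- The induction hypothesis. The length of a cycle is counted without the two vertices of R and J.
  WinsBelow : ℕ → Set
  WinsBelow N = ∀ {r a j b d} → Cycle r a j b → length a + length b < N →
                d ≢ r → d ≢ j → Wins r j d

  -- R and J step towards each other along the free arc. With at most one inner vertex they meet at
  -- once; otherwise the arc loses both end vertices and `next` takes over.
  advance : ∀ {r b j d} → Path r b j → d ∉ b → d ≢ r → d ≢ j →
            (∀ r′ b′ j′ d′ → b ≡ r′ ∷ b′ ++ ⟨ j′ ⟩ → Path r′ b′ j′ →
             r ~ r′ → j ~ j′ → Move d d′ → d′ ≢ r′ → d′ ≢ j′ → Wins r′ j′ d′) →
            Wins r j d
  advance {j = j} (edge e) d∉ d≢r d≢j next =
    moveR j e (≢-sym d≢j) d≢j λ _ _ _ _ → meet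
  advance (_∷_ {x = x} e p) d∉ d≢r d≢j next with unsnoc p
  ... | inj₁ (refl , e′) =
    move x x (inj₂ e) (inj₂ (~-sym e′)) x≢d x≢d λ _ _ _ _ → meet
    where x≢d = λ x≡d → d∉ (here (sym x≡d))
  ... | inj₂ (b′ , y , refl , q , e′) =
    move x y (inj₂ e) (inj₂ (~-sym e′))
      (λ x≡d → d∉ (here (sym x≡d)))
      (λ y≡d → d∉ (there (∈-++⁺ʳ b′ (here (sym y≡d)))))
      λ d′ → next x b′ y d′ refl q e (~-sym e′)

  -- The game on theta graphs.

  -- Three internally disjoint paths between q and z, with R inside the first and
  -- J inside the second. The bounds say that the induction applies to the two
  -- cycles through the third path.
  record Theta (N : ℕ) (r j q z : V) (u w u′ w′ e : List V) : Set where
    field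
      r⟶q : Path r u q
      r⟶z : Path r w z
      j⟶q : Path j u′ q
      j⟶z : Path j w′ z
      z⟶q : Path z e q
      unique : Unique (q ∷ z ∷ (r ∷ u ++ w) ++ (j ∷ u′ ++ w′) ++ e)
      small  : suc (length u + length w + length e) < N
      small′ : suc (length u′ + length w′ + length e) < N

  Theta-sym : ∀ {N r j q z u w u′ w′ e} →
              Theta N r j q z u w u′ w′ e → Theta N j r q z u′ w′ u w e
  Theta-sym {r = r} {j} {q} {z} {u} {w} {u′} {w′} {e} θ = record
    { r⟶q = j⟶q ; r⟶z = j⟶z ; j⟶q = r⟶q ; j⟶z = r⟶z ; z⟶q = z⟶q
    ; unique = Unique-resp-↭
        (solve 5 (λ a b c d e → a ⊕ b ⊕ c ⊕ d ⊕ e ⊜ a ⊕ b ⊕ d ⊕ c ⊕ e) ↭-refl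
          ⟨ q ⟩ ⟨ z ⟩ (r ∷ u ++ w) (j ∷ u′ ++ w′) e) unique
    ; small = small′ ; small′ = small }
    where open Theta θ

  Theta-step : ∀ {N r j q z x u w u′ w′ e} →
               Theta N r j q z (x ∷ u) w u′ w′ e → r ~ x × Theta N x j q z u (r ∷ w) u′ w′ e
  Theta-step {N} {r} {j} {q} {z} {x} {u} {w} {u′} {w′} {e} θ with Theta.r⟶q θ
  ... | r~x ∷ p = r~x , record
    { r⟶q = p ; r⟶z = ~-sym r~x ∷ r⟶z ; j⟶q = j⟶q ; j⟶z = j⟶z ; z⟶q = z⟶q
    ; unique = Unique-resp-↭
        (solve 8 (λ q z r x u w l e → q ⊕ z ⊕ (r ⊕ x ⊕ u ⊕ w) ⊕ l ⊕ e
                                    ⊜ q ⊕ z ⊕ (x ⊕ u ⊕ r ⊕ w) ⊕ l ⊕ e) ↭-refl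
          ⟨ q ⟩ ⟨ z ⟩ ⟨ r ⟩ ⟨ x ⟩ u w (j ∷ u′ ++ w′) e) unique
    ; small = subst (λ m → suc (m + length e) < N) (sym (+-suc (length u) (length w))) small
    ; small′ = small′ }
    where open Theta θ

  Theta-reflect : ∀ {N r j q z u w u′ w′ e} → Theta N r j q z u w u′ w′ e →
                  ∃ λ e′ → Theta N r j z q w u w′ u′ e′
  Theta-reflect {N} {r} {j} {q} {z} {u} {w} {u′} {w′} {e} θ with reversePath (Theta.z⟶q θ)
  ... | e′ , q⟶z , e′↭e = e′ , record
    { r⟶q = r⟶z ; r⟶z = r⟶q ; j⟶q = j⟶z ; j⟶z = j⟶q ; z⟶q = q⟶z
    ; unique = Unique-resp-↭
        (solve 9 (λ q z r u w j u′ w′ e → e ⊕ q ⊕ z ⊕ (r ⊕ u ⊕ w) ⊕ (j ⊕ u′ ⊕ w′)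
                                       ⊜ z ⊕ q ⊕ (r ⊕ w ⊕ u) ⊕ (j ⊕ w′ ⊕ u′) ⊕ e) ↭-refl
          ⟨ q ⟩ ⟨ z ⟩ ⟨ r ⟩ u w ⟨ j ⟩ u′ w′ e′)
        (Unique-replace _ (↭-sym e′↭e) (Unique-resp-↭
          (solve 5 (λ q z l m e → q ⊕ z ⊕ l ⊕ m ⊕ e ⊜ e ⊕ q ⊕ z ⊕ l ⊕ m) ↭-refl
            ⟨ q ⟩ ⟨ z ⟩ (r ∷ u ++ w) (j ∷ u′ ++ w′) e) unique))
    ; small  = shrunk (length u) (length w) small
    ; small′ = shrunk (length u′) (length w′) small′ }
    where
    open Theta θ
    shrunk : ∀ k l → suc (k + l + length e) < N → suc (l + k + length e′) < N
    shrunk k l rewrite +-comm l k | ↭-length e′↭e = id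

  -- The cycle through `e` that contains J, seen from `j` and `q`: once R stands on `q`, the
  -- induction hypothesis applies to it.
  Theta-ring : ∀ {N r j q z u w u′ w′ e} → Theta N r j q z u w u′ w′ e →
               Cycle j u′ q (w′ ++ z ∷ e) × length u′ + length (w′ ++ z ∷ e) < N
  Theta-ring {N} {r} {j} {q} {z} {u} {w} {u′} {w′} {e} θ =
    cycle j⟶q (join j⟶z z⟶q)
      (Unique-++⁻ˡ _ (Unique-resp-↭
        (solve 7 (λ q z l j u w e → q ⊕ z ⊕ l ⊕ (j ⊕ u ⊕ w) ⊕ e
                                  ⊜ (j ⊕ q ⊕ u ⊕ w ⊕ z ⊕ e) ⊕ l) ↭-refl
          ⟨ q ⟩ ⟨ z ⟩ (r ∷ u ++ w) ⟨ j ⟩ u′ w′ e) unique)) ,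
    subst (_< N) size small′
    where
    open Theta θ
    size : suc (length u′ + length w′ + length e) ≡ length u′ + length (w′ ++ z ∷ e)
    size rewrite length-++ w′ {z ∷ e} =
      solveℕ 3 (λ u w e → con 1 :+ (u :+ w :+ e) := u :+ (w :+ (con 1 :+ e))) refl
        (length u′) (length w′) (length e)

  Theta-distinct : ∀ {N r j q z u w u′ w′ e} → Theta N r j q z u w u′ w′ e →
                   q ≢ z × q ≢ r × q ≢ j
  Theta-distinct {r = r} {u = u} {w} θ with Theta.unique θ
  ... | q# ∷ _ = lookup q# (here refl) , lookup q# (there (here refl)) ,
                 lookup q# (there (∈-++⁺ʳ (r ∷ u ++ w) (here refl)))

  -- While j ~ q, Divider may not leave q: otherwise J enters q, joining R on a
  -- shorter cycle. So R walks unhindered to z, which lies on a shorter cycle with j.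
  pinned-wins : ∀ {N} → WinsBelow N → ∀ {r j q z u w′ e} w →
                Theta N r j q z u w [] w′ e → Wins r j q
  pinned-wins ih [] θ with Theta-reflect θ | Theta-distinct θ | Theta.r⟶z θ
  ... | _ , θ⁻ | q≢z , q≢r , q≢j | edge r~z =
    moveR _ r~z (≢-sym q≢z) q≢j λ d′ _ d′≢z d′≢j →
      let c , small = Theta-ring θ⁻ in Wins-sym (ih c small d′≢j d′≢z)
  pinned-wins ih {r} {j} {q} {z} {u} {w′} {e} (x ∷ w) θ
    with Theta-reflect θ
  -- `Theta-step` moves R towards the first branch vertex, so reflecting before and after it moves R
  -- towards `z` instead.
  ... | _ , θ⁻ with Theta-step θ⁻
  ... | r~x , θ⁻₁ with Theta-reflect θ⁻₁
  ... | _ , θ₁ with Theta.j⟶q θ₁ | Theta-distinct θ₁ | Theta-distinct θ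
  ... | edge j~q | _ , q≢x , _ | _ , _ , q≢j =
    moveR x r~x (≢-sym q≢x) q≢j λ d′ _ d′≢x d′≢j → continue d′ d′≢x d′≢j
    where
    continue : ∀ d′ → d′ ≢ x → d′ ≢ j → Wins x j d′
    continue d′ d′≢x d′≢j with d′ ≟ q
    ... | yes refl = pinned-wins ih w θ₁
    ... | no d′≢q  = moveJ q j~q (≢-sym d′≢q) d′≢x λ d″ _ d″≢x d″≢q →
      let c , small = Theta-ring (Theta-sym θ₁) in ih c small d″≢x d″≢q

  -- R and J approach `q` one step at a time, and the first to enter it joins the cycle of the
  -- other. The agent cannot block both next vertices unless both are `q`, which is the case of
  -- `pinned-wins`.
  theta-wins : ∀ {N} → WinsBelow N → ∀ {r j q z w w′ e d} u u′ →
               Theta N r j q z u w u′ w′ e → d ≢ r → d ≢ j → Wins r j d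

  stepR-wins : ∀ {N} → WinsBelow N → ∀ {r j q z x w w′ e d} u u′ →
               Theta N r j q z (x ∷ u) w u′ w′ e → x ≢ d → d ≢ j → Wins r j d
  stepJ-wins : ∀ {N} → WinsBelow N → ∀ {r j q z y w w′ e d} u u′ →
               Theta N r j q z u w (y ∷ u′) w′ e → y ≢ d → d ≢ r → Wins r j d
  finishR-wins : ∀ {N} → WinsBelow N → ∀ {r j q z w u′ w′ e d} →
                 Theta N r j q z [] w u′ w′ e → q ≢ d → d ≢ j → Wins r j d

  stepR-wins ih u u′ θ x≢d d≢j with Theta-step θ
  ... | r~x , θ₁ = moveR _ r~x x≢d d≢j λ _ _ → theta-wins ih u u′ θ₁

  stepJ-wins ih u u′ θ y≢d d≢r with Theta-step (Theta-sym θ)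
  ... | j~y , θ₁ = moveJ _ j~y y≢d d≢r λ _ _ → theta-wins ih u u′ (Theta-sym θ₁)

  finishR-wins ih θ q≢d d≢j with Theta.r⟶q θ
  ... | edge r~q = moveR _ r~q q≢d d≢j λ d′ _ d′≢q d′≢j →
    let c , small = Theta-ring θ in Wins-sym (ih c small d′≢j d′≢q)

  theta-wins ih {q = q} {d = d} [] u′ θ d≢r d≢j with q ≟ d
  ... | no q≢d = finishR-wins ih θ q≢d d≢j
  theta-wins ih [] []       θ d≢r d≢j | yes refl = pinned-wins ih _ θ
  theta-wins ih [] (y ∷ u′) θ d≢r d≢j | yes refl =
    stepJ-wins ih [] u′ θ (≢-sym q≢y) d≢r
    where q≢y = proj₁ (proj₂ (Theta-distinct (proj₂ (Theta-step (Theta-sym θ)))))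
  theta-wins ih {d = d} (x ∷ u) u′ θ d≢r d≢j with x ≟ d
  ... | no x≢d = stepR-wins ih u u′ θ x≢d d≢j
  theta-wins ih (x ∷ u) [] θ d≢r d≢j | yes refl =
    Wins-sym (finishR-wins ih (Theta-sym θ) q≢x d≢r)
    where q≢x = proj₁ (proj₂ (Theta-distinct (proj₂ (Theta-step θ))))
  theta-wins ih {r} {j} {q} {z} {w} {w′} {e} (x ∷ u) (y ∷ u′) θ d≢r d≢j | yes refl =
    stepJ-wins ih (x ∷ u) u′ θ y≢x d≢r
    where
    y≢x = Unique⇒≢ (Unique-resp-↭
      (solve 9 (λ q z r x u l y m e → q ⊕ z ⊕ (r ⊕ x ⊕ u) ⊕ (l ⊕ y ⊕ m) ⊕ e
                                    ⊜ y ⊕ x ⊕ q ⊕ z ⊕ r ⊕ u ⊕ l ⊕ m ⊕ e) ↭-refl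
        ⟨ q ⟩ ⟨ z ⟩ ⟨ r ⟩ ⟨ x ⟩ (u ++ w) ⟨ j ⟩ ⟨ y ⟩ (u′ ++ w′) e)
      (Theta.unique θ))

  -- The route of the agent since it last touched the cycle.

  -- A path from d to q of length at most ℓ whose vertices other than q avoid X.
  data Tether (X : List V) (q : V) : V → ℕ → Set where
    here : ∀ {ℓ} → Tether X q q ℓ
    away : ∀ {d e ℓ} → Path d e q → Unique (d ∷ e) →
           (∀ {v} → v ∈ d ∷ e → v ∉ X) → length e < ℓ → Tether X q d ℓ

  Tether-mono : ∀ {X Y q d ℓ ℓ′} → (∀ {v} → v ∈ Y → v ∈ X) → ℓ ≤ ℓ′ →
                Tether X q d ℓ → Tether Y q d ℓ′
  Tether-mono Y⊆X ℓ≤ here           = here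
  Tether-mono Y⊆X ℓ≤ (away p u ∉X <ℓ) = away p u (λ i → ∉X i ∘ Y⊆X) (<-≤-trans <ℓ ℓ≤)

  -- The tether grows by one edge, unless the agent returns to it; then it is cut at `d′` and so
  -- stays simple.
  extend : ∀ {X q d d′ ℓ} → Tether X q d ℓ → d ~ d′ → d′ ∉ X → Tether X q d′ (suc ℓ)
  extend here e d′∉ =
    away (edge (~-sym e)) ([] ∷ []) (λ { (here refl) → d′∉ }) (s≤s z≤n)
  extend {d = d} {d′} (away {e = e} p u ∉X <ℓ) d~d′ d′∉ with d′ ∈? (d ∷ e)
  ... | no d′∉e = away (~-sym d~d′ ∷ p) (Unique-∷ d′∉e u)
        (λ { (here refl) → d′∉ ; (there i) → ∉X i }) (s≤s <ℓ)
  ... | yes (here refl) = away p u ∉X (m≤n⇒m≤1+n <ℓ)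
  ... | yes (there i) with ∈-∃++ i
  ... | e₁ , e₂ , refl = away (proj₂ (split e₁ p)) (Unique-++⁻ʳ (d ∷ e₁) u)
        (∉X ∘ ∈-++⁺ʳ (d ∷ e₁))
        (m≤n⇒m≤1+n (<-trans (length-++-≤ʳ (d′ ∷ e₂) {xs = e₁}) <ℓ))

  ear : ∀ {X q d z ℓ} → Tether X q d ℓ → d ~ z →
        ∃ λ e → Path z e q × Unique e × (∀ {v} → v ∈ e → v ∉ X) × length e ≤ ℓ
  ear here           d~z = [] , edge (~-sym d~z) , [] , (λ ()) , z≤n
  ear (away p u ∉X <ℓ) d~z = -, ~-sym d~z ∷ p , u , ∉X , <ℓ

  -- The chase along one arc of a cycle.

  ring : (r j q : V) (a₁ a₂ b : List V) → List V
  ring r j q a₁ a₂ b = q ∷ r ∷ j ∷ a₁ ++ a₂ ++ b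

  -- The cycle with arcs r a₁ q a₂ʳ j and r b j.
  record Ring (N : ℕ) (r j q : V) (a₁ a₂ b : List V) : Set where
    field
      r⟶q : Path r a₁ q
      j⟶q : Path j a₂ q
      r⟶j : Path r b j
      unique : Unique (ring r j q a₁ a₂ b)
      size : suc (length a₁ + length a₂ + length b) ≤ N

  -- `ℓ` bounds the number of rounds from which the tether results. In each of them R and J move
  -- away from `q`, adding a vertex to `a₁` and to `a₂`; hence the last two fields persist.
  record Chase (N : ℕ) (r j d : V) (b : List V) : Set where
    field
      {q} : V
      {a₁ a₂} : List V
      {ℓ} : ℕ
      onRing : Ring N r j q a₁ a₂ b
      tether : Tether (ring r j q a₁ a₂ b) q d ℓ
      near₁  : ℓ ≤ length a₁
      near₂  : ℓ ≤ length a₂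

  anchored : ∀ {N r j q a₁ a₂ b} → Ring N r j q a₁ a₂ b → Chase N r j q b
  anchored R = record { onRing = R ; tether = here {ℓ = 0} ; near₁ = z≤n ; near₂ = z≤n }

  -- The agent touches the cycle anew at `d`, so the tether starts afresh there. The part of `a₁`
  -- beyond `d` is reversed and passes, with `q`, to the path from `j`.
  reanchor₁ : ∀ {N r j q d a₂ b} c₁ c₂ →
              Ring N r j q (c₁ ++ d ∷ c₂) a₂ b → Chase N r j d b
  reanchor₁ {N} {r} {j} {q} {d} {a₂} {b} c₁ c₂ R
    with split c₁ (Ring.r⟶q R)
  ... | r⟶d , d⟶q with reversePath d⟶q
  ... | c₂′ , q⟶d , c₂′↭c₂ = anchored record
    { r⟶q = r⟶d ; j⟶q = join j⟶q q⟶d ; r⟶j = r⟶j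
    ; unique = Unique-resp-↭
        (solve 8 (λ q r j c d c′ a b → c′ ⊕ q ⊕ r ⊕ j ⊕ c ⊕ d ⊕ a ⊕ b
                                     ⊜ d ⊕ r ⊕ j ⊕ c ⊕ (a ⊕ q ⊕ c′) ⊕ b) ↭-refl
          ⟨ q ⟩ ⟨ r ⟩ ⟨ j ⟩ c₁ ⟨ d ⟩ c₂′ a₂ b)
        (Unique-replace _ (↭-sym c₂′↭c₂) (Unique-resp-↭
          (solve 8 (λ q r j c d c′ a b → q ⊕ r ⊕ j ⊕ (c ⊕ d ⊕ c′) ⊕ a ⊕ b
                                       ⊜ c′ ⊕ q ⊕ r ⊕ j ⊕ c ⊕ d ⊕ a ⊕ b) ↭-refl
            ⟨ q ⟩ ⟨ r ⟩ ⟨ j ⟩ c₁ ⟨ d ⟩ c₂ a₂ b) unique))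
    ; size = subst (_≤ N) size-≡ size }
    where
    open Ring R
    size-≡ : suc (length (c₁ ++ d ∷ c₂) + length a₂ + length b) ≡
             suc (length c₁ + length (a₂ ++ q ∷ c₂′) + length b)
    size-≡ rewrite length-++ c₁ {d ∷ c₂} | length-++ a₂ {q ∷ c₂′} | ↭-length c₂′↭c₂ =
      solveℕ 4 (λ c c′ a b → con 1 :+ (c :+ (con 1 :+ c′) :+ a :+ b) :=
                             con 1 :+ (c :+ (a :+ (con 1 :+ c′)) :+ b)) refl
        (length c₁) (length c₂) (length a₂) (length b)

  reanchor₂ : ∀ {N r j q d a₁ b} c₁ c₂ →
              Ring N r j q a₁ (c₁ ++ d ∷ c₂) b → Chase N r j d b
  reanchor₂ {N} {r} {j} {q} {d} {a₁} {b} c₁ c₂ R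
    with split c₁ (Ring.j⟶q R)
  ... | j⟶d , d⟶q with reversePath d⟶q
  ... | c₂′ , q⟶d , c₂′↭c₂ = anchored record
    { r⟶q = join r⟶q q⟶d ; j⟶q = j⟶d ; r⟶j = r⟶j
    ; unique = Unique-resp-↭
        (solve 8 (λ q r j c d c′ a b → c′ ⊕ q ⊕ r ⊕ j ⊕ c ⊕ d ⊕ a ⊕ b
                                     ⊜ d ⊕ r ⊕ j ⊕ (a ⊕ q ⊕ c′) ⊕ c ⊕ b) ↭-refl
          ⟨ q ⟩ ⟨ r ⟩ ⟨ j ⟩ c₁ ⟨ d ⟩ c₂′ a₁ b)
        (Unique-replace _ (↭-sym c₂′↭c₂) (Unique-resp-↭
          (solve 8 (λ q r j c d c′ a b → q ⊕ r ⊕ j ⊕ a ⊕ (c ⊕ d ⊕ c′) ⊕ b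
                                       ⊜ c′ ⊕ q ⊕ r ⊕ j ⊕ c ⊕ d ⊕ a ⊕ b) ↭-refl
            ⟨ q ⟩ ⟨ r ⟩ ⟨ j ⟩ c₁ ⟨ d ⟩ c₂ a₁ b) unique))
    ; size = subst (_≤ N) size-≡ size }
    where
    open Ring R
    size-≡ : suc (length a₁ + length (c₁ ++ d ∷ c₂) + length b) ≡
             suc (length (a₁ ++ q ∷ c₂′) + length c₁ + length b)
    size-≡ rewrite length-++ c₁ {d ∷ c₂} | length-++ a₁ {q ∷ c₂′} | ↭-length c₂′↭c₂ =
      solveℕ 4 (λ c c′ a b → con 1 :+ (a :+ (c :+ (con 1 :+ c′)) :+ b) :=
                             con 1 :+ (a :+ (con 1 :+ c′) :+ c :+ b)) refl
        (length c₁) (length c₂) (length a₁) (length b)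

  -- The cycle through the ear that keeps one of R and J trades the other's path to `q`, of length
  -- `y`, for the ear, of length `x`. It also loses the other's own vertex, which makes the
  -- inequality strict.
  shortcut-size : ∀ k l m {x y} → x ≤ y → suc (k + l + x) < suc (k + y + (l + suc m))
  shortcut-size k l m {x} {y} x≤y = begin
    suc (suc (k + l + x))       ≤⟨ s≤s (s≤s (+-monoʳ-≤ (k + l) x≤y)) ⟩
    suc (suc (k + l + y))       ≤⟨ m≤m+n _ m ⟩
    suc (suc (k + l + y)) + m   ≡⟨ solveℕ 4 (λ k l y m →
                                     con 2 :+ (k :+ l :+ y) :+ m :=
                                     con 1 :+ (k :+ y :+ (l :+ (con 1 :+ m)))) refl k l y m ⟩
    suc (k + y + (l + suc m))   ∎
    where open ≤-Reasoning

  shortcut : ∀ {N r j q a₁ a₂ z e} b₁ b₂ → Ring N r j q a₁ a₂ (b₁ ++ z ∷ b₂) →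
             Path z e q → Unique e →
             (∀ {v} → v ∈ e → v ∉ ring r j q a₁ a₂ (b₁ ++ z ∷ b₂)) →
             length e ≤ length a₁ → length e ≤ length a₂ →
             ∃ λ b₂′ → Theta N r j q z a₁ b₁ a₂ b₂′ e
  shortcut {N} {r} {j} {q} {a₁} {a₂} {z} {e} b₁ b₂ R p ue ∉X ≤a₁ ≤a₂
    with split b₁ (Ring.r⟶j R)
  ... | r⟶z , z⟶j with reversePath z⟶j
  ... | b₂′ , j⟶z , b₂′↭b₂ = b₂′ , record
    { r⟶q = r⟶q ; r⟶z = r⟶z ; j⟶q = j⟶q ; j⟶z = j⟶z ; z⟶q = p
    ; unique = Unique-resp-↭
        (solve 9 (λ q r j a b z c d e → c ⊕ q ⊕ r ⊕ j ⊕ a ⊕ b ⊕ d ⊕ z ⊕ e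
                                      ⊜ q ⊕ z ⊕ (r ⊕ a ⊕ d) ⊕ (j ⊕ b ⊕ c) ⊕ e) ↭-refl
          ⟨ q ⟩ ⟨ r ⟩ ⟨ j ⟩ a₁ a₂ ⟨ z ⟩ b₂′ b₁ e)
        (Unique-replace _ (↭-sym b₂′↭b₂) (Unique-resp-↭
          (solve 9 (λ q r j a b z c d e → e ⊕ q ⊕ r ⊕ j ⊕ a ⊕ b ⊕ d ⊕ z ⊕ c
                                        ⊜ c ⊕ q ⊕ r ⊕ j ⊕ a ⊕ b ⊕ d ⊕ z ⊕ e) ↭-refl
            ⟨ q ⟩ ⟨ r ⟩ ⟨ j ⟩ a₁ a₂ ⟨ z ⟩ b₂ b₁ e)
          (Unique.++⁺ ue unique (λ (i , k) → ∉X i k))))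
    ; small = <-≤-trans (shortcut-size (length a₁) (length b₁) (length b₂) ≤a₂)
                (subst (_≤ N) size₁ size)
    ; small′ = <-≤-trans (shortcut-size (length a₂) (length b₂′) (length b₁) ≤a₁)
                (subst (_≤ N) size₂ size) }
    where
    open Ring R
    size₁ : suc (length a₁ + length a₂ + length (b₁ ++ z ∷ b₂)) ≡
            suc (length a₁ + length a₂ + (length b₁ + suc (length b₂)))
    size₁ = cong (λ l → suc (length a₁ + length a₂ + l)) (length-++ b₁)
    size₂ : suc (length a₁ + length a₂ + length (b₁ ++ z ∷ b₂)) ≡
            suc (length a₂ + length a₁ + (length b₂′ + suc (length b₁)))
    size₂ rewrite length-++ b₁ {z ∷ b₂} | ↭-length b₂′↭b₂ =
      solveℕ 4 (λ a a′ b b′ → con 1 :+ (a :+ a′ :+ (b :+ (con 1 :+ b′))) :=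
                              con 1 :+ (a′ :+ a :+ (b′ :+ (con 1 :+ b)))) refl
        (length a₁) (length a₂) (length b₁) (length b₂)

  -- R and J have just moved, so the bounds on `ℓ` are strict and leave room for one more edge. Off
  -- the ring the tether grows; on `q`, `a₁` or `a₂` it is anchored anew; on `b` it closes to the
  -- third path of a theta graph.
  respond : ∀ {N r j q a₁ a₂ b d d′ ℓ} → Ring N r j q a₁ a₂ b →
            Tether (ring r j q a₁ a₂ b) q d ℓ → ℓ < length a₁ → ℓ < length a₂ →
            Move d d′ → d′ ≢ r → d′ ≢ j →
            Chase N r j d′ b ⊎
            (∃₂ λ u u′ → ∃₂ λ w w′ → ∃₂ λ z e → Theta N r j q z u w u′ w′ e)
  respond R t ℓ<₁ ℓ<₂ (inj₁ refl) _ _ =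
    inj₁ record { onRing = R ; tether = t ; near₁ = <⇒≤ ℓ<₁ ; near₂ = <⇒≤ ℓ<₂ }
  respond {r = r} {j} {q} {a₁} {a₂} {b} {d′ = d′} R t ℓ<₁ ℓ<₂ (inj₂ d~d′) d′≢r d′≢j
    with d′ ∈? ring r j q a₁ a₂ b
  ... | no d′∉ =
    inj₁ record { onRing = R ; tether = extend t d~d′ d′∉ ; near₁ = ℓ<₁ ; near₂ = ℓ<₂ }
  ... | yes (here refl) = inj₁ (anchored R)
  ... | yes (there (here refl)) = ⊥-elim (d′≢r refl)
  ... | yes (there (there (here refl))) = ⊥-elim (d′≢j refl)
  ... | yes (there (there (there i))) with ∈-++⁻ a₁ i
  ... | inj₁ i₁ with ∈-∃++ i₁
  ... | c₁ , c₂ , refl = inj₁ (reanchor₁ c₁ c₂ R)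
  respond {a₁ = a₁} {a₂} R t ℓ<₁ ℓ<₂ (inj₂ d~d′) _ _ | yes (there (there (there _))) | inj₂ i′
    with ∈-++⁻ a₂ i′
  ... | inj₁ i₂ with ∈-∃++ i₂
  ... | c₁ , c₂ , refl = inj₁ (reanchor₂ c₁ c₂ R)
  respond R t ℓ<₁ ℓ<₂ (inj₂ d~d′) _ _ | yes (there (there (there _))) | inj₂ _ | inj₂ i₃
    with ∈-∃++ i₃
  ... | b₁ , b₂ , refl with ear t d~d′
  ... | e , p , ue , ∉X , ≤ℓ
    with shortcut b₁ b₂ R p ue ∉X (≤-trans ≤ℓ (<⇒≤ ℓ<₁)) (≤-trans ≤ℓ (<⇒≤ ℓ<₂))
  ... | b₂′ , θ = inj₂ (-, -, -, -, -, -, θ)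

  -- The cycle is the same, only divided differently; the permutation carries the tether over.
  Ring-advance : ∀ {N r j q a₁ a₂ r′ b j′} → Ring N r j q a₁ a₂ (r′ ∷ b ++ ⟨ j′ ⟩) →
                 Path r′ b j′ → r ~ r′ → j ~ j′ →
                 Ring N r′ j′ q (r ∷ a₁) (j ∷ a₂) b ×
                 ring r j q a₁ a₂ (r′ ∷ b ++ ⟨ j′ ⟩) ↭ ring r′ j′ q (r ∷ a₁) (j ∷ a₂) b
  Ring-advance {N} {r} {j} {q} {a₁} {a₂} {r′} {b} {j′} R p r~r′ j~j′ = record
    { r⟶q = ~-sym r~r′ ∷ r⟶q ; j⟶q = ~-sym j~j′ ∷ j⟶q ; r⟶j = p
    ; unique = Unique-resp-↭ same unique
    ; size = subst (_≤ N) size-≡ size } , same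
    where
    open Ring R
    same = solve 8 (λ q r j a c r′ b j′ → q ⊕ r ⊕ j ⊕ a ⊕ c ⊕ (r′ ⊕ b ⊕ j′)
                                        ⊜ q ⊕ r′ ⊕ j′ ⊕ (r ⊕ a) ⊕ (j ⊕ c) ⊕ b) ↭-refl
             ⟨ q ⟩ ⟨ r ⟩ ⟨ j ⟩ a₁ a₂ ⟨ r′ ⟩ b ⟨ j′ ⟩
    size-≡ : suc (length a₁ + length a₂ + length (r′ ∷ b ++ ⟨ j′ ⟩)) ≡
             suc (suc (length a₁) + suc (length a₂) + length b)
    size-≡ rewrite length-++ b {⟨ j′ ⟩} =
      solveℕ 3 (λ a c b → con 1 :+ (a :+ c :+ (con 1 :+ (b :+ con 1))) :=
                          con 1 :+ (con 1 :+ a :+ (con 1 :+ c) :+ b)) refl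
        (length a₁) (length a₂) (length b)

  -- Induction on the bound `k` for the arc `b`, which loses two vertices per round. The agent is
  -- never on `b`: it is on `q` or off the ring.
  chase-wins : ∀ {N} → WinsBelow N → ∀ k {r j d b} → Chase N r j d b →
               length b ≤ k → d ≢ r → d ≢ j → Wins r j d
  chase-wins {N} ih k {r} {j} {d} {b} C b≤k d≢r d≢j =
    advance (Ring.r⟶j onRing) d∉b d≢r d≢j λ where
      r′ b′ j′ d′ refl p r~r′ j~j′ m d′≢r′ d′≢j′ → next k C b≤k p r~r′ j~j′ m d′≢r′ d′≢j′
    where
    open Chase C
    d∉b : d ∉ b
    d∉b i with tether
    ... | here = Unique.Unique[x∷xs]⇒x∉xs (Ring.unique onRing)
                   (there (there (∈-++⁺ʳ a₁ (∈-++⁺ʳ a₂ i))))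
    ... | away _ _ ∉X _ = ∉X (here refl) (there (there (there (∈-++⁺ʳ a₁ (∈-++⁺ʳ a₂ i)))))
    next : ∀ k {r j d r′ b′ j′ d′} → Chase N r j d (r′ ∷ b′ ++ ⟨ j′ ⟩) →
           length (r′ ∷ b′ ++ ⟨ j′ ⟩) ≤ k → Path r′ b′ j′ → r ~ r′ → j ~ j′ →
           Move d d′ → d′ ≢ r′ → d′ ≢ j′ → Wins r′ j′ d′
    next (suc k) {b′ = b′} C b≤k p r~r′ j~j′ m d′≢r′ d′≢j′
      with Ring-advance (Chase.onRing C) p r~r′ j~j′
    ... | R , same
      with respond R (Tether-mono (∈-resp-↭ (↭-sym same)) ≤-refl (Chase.tether C))
             (s≤s (Chase.near₁ C)) (s≤s (Chase.near₂ C)) m d′≢r′ d′≢j′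
    ... | inj₁ C′ = chase-wins ih k C′
            (≤-trans (length-++-≤ˡ b′) (s≤s⁻¹ b≤k))
            d′≢r′ d′≢j′
    ... | inj₂ (_ , _ , _ , _ , _ , _ , θ) = theta-wins ih _ _ θ d′≢r′ d′≢j′

  -- Induction on the length of the cycle.

  -- While the agent is off the cycle, R and J advance along `b` and `a` grows by their old
  -- vertices. As soon as the agent is on an arc, the chase runs along the other one.
  cycle-wins-≤ : ∀ {N} → WinsBelow N → ∀ k {r a j b d} → Cycle r a j b →
                 length a + length b ≤ N → length b ≤ k → d ≢ r → d ≢ j → Wins r j d

  -- The vertex of the agent divides `a` and serves as the anchor of a chase along `b`.
  enter : ∀ {N} → WinsBelow N → ∀ {r a j b d} → Cycle r a j b →
          length a + length b ≤ N → d ∈ a → d ≢ r → d ≢ j → Wins r j d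
  enter {N} ih {r} {a} {j} {b} {d} (cycle p p′ u) a+b≤N d∈a with ∈-∃++ d∈a
  ... | a₁ , a₂ , refl with split a₁ p
  ... | r⟶d , d⟶j with reversePath d⟶j
  ... | a₂′ , j⟶d , a₂′↭a₂ = chase-wins ih (length b) (anchored record
    { r⟶q = r⟶d ; j⟶q = j⟶d ; r⟶j = p′
    ; unique = Unique-resp-↭
        (solve 6 (λ d r j a a′ b → a′ ⊕ d ⊕ r ⊕ j ⊕ a ⊕ b ⊜ d ⊕ r ⊕ j ⊕ a ⊕ a′ ⊕ b) ↭-refl
          ⟨ d ⟩ ⟨ r ⟩ ⟨ j ⟩ a₁ a₂′ b)
        (Unique-replace _ (↭-sym a₂′↭a₂) (Unique-resp-↭
          (solve 6 (λ d r j a a′ b → r ⊕ j ⊕ (a ⊕ d ⊕ a′) ⊕ b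
                                   ⊜ a′ ⊕ d ⊕ r ⊕ j ⊕ a ⊕ b) ↭-refl
            ⟨ d ⟩ ⟨ r ⟩ ⟨ j ⟩ a₁ a₂ b) u))
    ; size = subst (_≤ N) size-≡ a+b≤N }) ≤-refl
    where
    size-≡ : length (a₁ ++ d ∷ a₂) + length b ≡ suc (length a₁ + length a₂′ + length b)
    size-≡ rewrite length-++ a₁ {d ∷ a₂} | ↭-length a₂′↭a₂ =
      cong (_+ length b) (+-suc (length a₁) (length a₂))

  cycle-wins-≤ {N} ih k {r} {a} {j} {b} {d} c@(cycle p p′ u) a+b≤N b≤k d≢r d≢j
    with d ∈? a | d ∈? b
  ... | yes d∈a | _ = enter ih c a+b≤N d∈a d≢r d≢j
  ... | no _    | yes d∈b =
    enter ih (cycle p′ p (Unique-resp-↭ (prep r (prep j (++-comm a b))) u))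
      (subst (_≤ N) (+-comm (length a) (length b)) a+b≤N) d∈b d≢r d≢j
  ... | no _    | no d∉b = advance p′ d∉b d≢r d≢j λ where
      r′ b′ j′ d′ refl q r~r′ j~j′ _ → next k {a} {b′} c a+b≤N b≤k q r~r′ j~j′
    where
    next : ∀ k {a b′ r j r′ j′ d′} → Cycle r a j (r′ ∷ b′ ++ ⟨ j′ ⟩) →
           length a + length (r′ ∷ b′ ++ ⟨ j′ ⟩) ≤ N → length (r′ ∷ b′ ++ ⟨ j′ ⟩) ≤ k →
           Path r′ b′ j′ → r ~ r′ → j ~ j′ → d′ ≢ r′ → d′ ≢ j′ → Wins r′ j′ d′
    next (suc k) {a} {b′} {r} {j} {r′} {j′} (cycle p _ u) ≤N ≤k q r~r′ j~j′ =
      cycle-wins-≤ ih k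
        (cycle (~-sym r~r′ ∷ snoc p j~j′) q (Unique-resp-↭
          (solve 6 (λ r j a r′ b j′ → r ⊕ j ⊕ a ⊕ (r′ ⊕ b ⊕ j′)
                                    ⊜ r′ ⊕ j′ ⊕ (r ⊕ a ⊕ j) ⊕ b) ↭-refl
            ⟨ r ⟩ ⟨ j ⟩ a ⟨ r′ ⟩ b′ ⟨ j′ ⟩) u))
        (subst (_≤ N) size-≡ ≤N)
        (≤-trans (length-++-≤ˡ b′) (s≤s⁻¹ ≤k))
      where
      size-≡ : length a + length (r′ ∷ b′ ++ ⟨ j′ ⟩) ≡ length (r ∷ a ++ ⟨ j ⟩) + length b′
      size-≡ rewrite length-++ b′ {⟨ j′ ⟩} | length-++ a {⟨ j ⟩} =
        solveℕ 2 (λ a b → a :+ (con 1 :+ (b :+ con 1)) := con 1 :+ (a :+ con 1) :+ b) refl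
          (length a) (length b′)

  cycle-wins : ∀ N → WinsBelow N
  cycle-wins (suc N) {b = b} c (s≤s a+b≤N) =
    cycle-wins-≤ (cycle-wins N) (length b) c a+b≤N ≤-refl

  -- A cycle through two vertices that no third vertex separates.

  -- Unlike in Path, the list includes the last vertex, so a tail may be trivial.
  data Tail : V → List V → V → Set where
    []  : ∀ {v} → Tail v [] v
    _∷_ : ∀ {u x xs v} → u ~ x → Tail x xs v → Tail u (x ∷ xs) v

  split-tail : ∀ {u x ys v} xs → Tail u (xs ++ x ∷ ys) v → Path u xs x × Tail x ys v
  split-tail []       (e ∷ p) = edge e , p
  split-tail (_ ∷ xs) (e ∷ p) with split-tail xs p
  ... | p₁ , p₂ = e ∷ p₁ , p₂

  end∈tail : ∀ {u x xs v} → Tail u (x ∷ xs) v → v ∈ x ∷ xs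
  end∈tail (_ ∷ [])        = here refl
  end∈tail (_ ∷ p@(_ ∷ _)) = there (end∈tail p)

  simple-tail : ∀ {u v} → Star _~_ u v → ∃ λ xs → Tail u xs v × Unique (u ∷ xs)
  simple-tail ε = [] , [] , [] ∷ []
  simple-tail {u} (_◅_ {j = x} e p) with simple-tail p
  ... | xs , q , uq with u ∈? (x ∷ xs)
  ... | no u∉ = x ∷ xs , e ∷ q , Unique-∷ u∉ uq
  ... | yes (here refl) = xs , q , uq
  ... | yes (there i) with ∈-∃++ i
  ... | ys , zs , refl = zs , proj₂ (split-tail ys q) , Unique-++⁻ʳ (x ∷ ys) uq

  -- The ear found runs from the last visit of X to the first visit of Y.
  crossing : ∀ {X Y v c t q ℓ} → Star (AdjOutside G ⁅ v ⁆) c t → t ∈ Y → c ∉ Y →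
             q ∈ X → Tether (v ∷ X ++ Y) q c ℓ →
             ∃ λ q → ∃₂ λ z e → q ∈ X × z ∈ Y × Path q e z × Unique e ×
               (∀ {x} → x ∈ e → x ∉ v ∷ X ++ Y)
  crossing ε t∈Y c∉Y _ _ = ⊥-elim (c∉Y t∈Y)
  crossing {X} {Y} {v} (_◅_ {j = c′} (_ , c′∉⁅v⁆ , e) p) t∈Y c∉Y q∈X t with c′ ∈? Y
  ... | yes c′∈Y with ear t e
  ... | _ , q , u , ∉X , _ with reversePath q
  ... | es , q′ , es↭ = -, -, es , q∈X , c′∈Y , q′ ,
        Unique-resp-↭ (↭-sym es↭) u , ∉X ∘ ∈-resp-↭ es↭
  crossing {X} {Y} {v} (_◅_ {j = c′} (_ , c′∉⁅v⁆ , e) p) t∈Y c∉Y q∈X t | no c′∉Y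
    with c′ ∈? X
  ... | yes c′∈X = crossing p t∈Y c′∉Y c′∈X (here {ℓ = 0})
  ... | no c′∉X  = crossing p t∈Y c′∉Y q∈X (extend t e c′∉)
    where
    c′∉ : c′ ∉ v ∷ X ++ Y
    c′∉ (here refl) = c′∉⁅v⁆ (x∈⁅x⁆ v)
    c′∉ (there i) with ∈-++⁻ X i
    ... | inj₁ i₁ = c′∉X i₁
    ... | inj₂ i₂ = c′∉Y i₂

  -- The cycle degenerates to the edge s v when a and b are empty.
  record Lollipop (s t v : V) (a b ys : List V) : Set where
    field
      path₁  : Path s a v
      path₂  : Path s b v
      tail   : Tail v ys t
      unique : Unique (s ∷ v ∷ a ++ b ++ ys)

  Lollipop-sym : ∀ {s t v a b ys} → Lollipop s t v a b ys → Lollipop s t v b a ys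
  Lollipop-sym {s} {t} {v} {a} {b} {ys} L = record
    { path₁ = path₂ ; path₂ = path₁ ; tail = tail
    ; unique = Unique-resp-↭
        (solve 5 (λ s v a b y → s ⊕ v ⊕ a ⊕ b ⊕ y ⊜ s ⊕ v ⊕ b ⊕ a ⊕ y) ↭-refl
          ⟨ s ⟩ ⟨ v ⟩ a b ys) unique }
    where open Lollipop L

  -- `rest` is the part of `a` that the new path drops. Keeping it makes disjointness a matter of
  -- one permutation.
  reroute : ∀ {s a v q e z} → Path s a v → q ∈ s ∷ a → Path q e z →
            ∃₂ λ a′ rest → Path s a′ z × a′ ++ rest ↭ a ++ e
  reroute {a = a} {e = e} p (here refl) q = e , a , q , ++-comm e a
  reroute {q = x} {e = e} p (there i) q with ∈-∃++ i
  ... | a₁ , a₂ , refl = -, a₂ , join (proj₁ (split a₁ p)) q ,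
        solve 4 (λ a x e b → (a ⊕ x ⊕ e) ⊕ b ⊜ (a ⊕ x ⊕ b) ⊕ e) ↭-refl a₁ ⟨ x ⟩ e a₂

  -- The new cycle runs from `s` along `a` to `q` and through the ear to `z` on one side, and along
  -- `b`, through `v` and along the tail to `z` on the other.
  lengthen : ∀ {s t v a b q e z} y₁ y₂ → Lollipop s t v a b (y₁ ++ z ∷ y₂) →
             q ∈ s ∷ a → Path q e z → Unique e →
             (∀ {x} → x ∈ e → x ∉ v ∷ (s ∷ a ++ b) ++ (y₁ ++ z ∷ y₂)) →
             ∃₂ λ a′ b′ → Lollipop s t z a′ b′ y₂
  lengthen {s} {t} {v} {a} {b} {q} {e} {z} y₁ y₂ L q∈ p ue e∉
    with reroute (Lollipop.path₁ L) q∈ p | split-tail y₁ (Lollipop.tail L)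
  ... | a′ , rest , p′ , same | v⟶z , tail′ = a′ , b ++ v ∷ y₁ , record
    { path₁ = p′ ; path₂ = join path₂ v⟶z ; tail = tail′
    ; unique = Unique-++⁻ˡ _ (Unique-resp-↭
        (solve 8 (λ a r s v b y z y′ → (a ⊕ r) ⊕ s ⊕ v ⊕ b ⊕ y ⊕ z ⊕ y′
                                     ⊜ (s ⊕ z ⊕ a ⊕ (b ⊕ v ⊕ y) ⊕ y′) ⊕ r) ↭-refl
          a′ rest ⟨ s ⟩ ⟨ v ⟩ b y₁ ⟨ z ⟩ y₂)
        (Unique-replace _ (↭-sym same) (Unique-resp-↭
          (solve 8 (λ a e s v b y z y′ → e ⊕ v ⊕ (s ⊕ a ⊕ b) ⊕ y ⊕ z ⊕ y′
                                       ⊜ (a ⊕ e) ⊕ s ⊕ v ⊕ b ⊕ y ⊕ z ⊕ y′) ↭-refl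
            a e ⟨ s ⟩ ⟨ v ⟩ b y₁ ⟨ z ⟩ y₂)
          (Unique.++⁺ ue (Unique-resp-↭
            (solve 5 (λ s v a b y → s ⊕ v ⊕ a ⊕ b ⊕ y ⊜ v ⊕ (s ⊕ a ⊕ b) ⊕ y) ↭-refl
              ⟨ s ⟩ ⟨ v ⟩ a b (y₁ ++ z ∷ y₂)) unique) (λ (i , k) → e∉ i k))))) }
    where open Lollipop L

  Biconnected : V → V → Set
  Biconnected s t = ∀ v → v ≢ s → v ≢ t → Star (AdjOutside G ⁅ v ⁆) s t

  -- Induction on the tail. A walk from `s` to `t` avoiding `v` contains an ear from the cycle to
  -- the tail, which yields a lollipop with a shorter tail. An empty tail means `v` is `t`.
  lollipop⇒cycle : ∀ k {s t v a b ys} → Biconnected s t → length ys ≤ k →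
                   Lollipop s t v a b ys → ∃₂ λ a b → Cycle s a t b
  lollipop-next : ∀ k {s t v a b ys q e z} → Biconnected s t → length ys ≤ suc k →
                  Lollipop s t v a b ys → q ∈ s ∷ a ++ b → z ∈ ys →
                  Path q e z → Unique e → (∀ {x} → x ∈ e → x ∉ v ∷ (s ∷ a ++ b) ++ ys) →
                  ∃₂ λ a b → Cycle s a t b
  lollipop-next k {s} {v = v} {a} {b} {z = z} H ≤k L q∈ z∈ p ue e∉ with ∈-∃++ z∈
  ... | y₁ , y₂ , refl with ∈-++⁻ (s ∷ a) q∈ | s≤s⁻¹ (≤-trans (length-++-≤ʳ (z ∷ y₂) {xs = y₁}) ≤k)
  ... | inj₁ q∈₁ | y₂≤k = lollipop⇒cycle k H y₂≤k (proj₂ (proj₂ (lengthen y₁ y₂ L q∈₁ p ue e∉)))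
  ... | inj₂ q∈₂ | y₂≤k = lollipop⇒cycle k H y₂≤k
        (proj₂ (proj₂ (lengthen y₁ y₂ (Lollipop-sym L) (there q∈₂) p ue e∉′)))
    where
    e∉′ : ∀ {x} → x ∈ _ → x ∉ v ∷ (s ∷ b ++ a) ++ (y₁ ++ z ∷ y₂)
    e∉′ i = e∉ i ∘ ∈-resp-↭ (prep v (++⁺ʳ _ (prep s (++-comm b a))))

  lollipop⇒cycle k {s} {a = a} {b} {[]} H _ L with Lollipop.tail L
  ... | [] = a , b , cycle path₁ path₂
        (subst (λ l → Unique (s ∷ _ ∷ a ++ l)) (++-identityʳ b) unique)
    where open Lollipop L
  lollipop⇒cycle (suc k) {s} {t} {v} {a} {b} {ys@(_ ∷ _)} H ≤k L
    with crossing {X = s ∷ a ++ b} {Y = ys} (H v v≢s v≢t) t∈ys s∉ys (here refl) (here {ℓ = 0})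
    where
    open Lollipop L
    t∈ys : t ∈ ys
    t∈ys = end∈tail tail
    v≢s : v ≢ s
    v≢s = ≢-sym (Unique⇒≢ unique)
    s∉ys : s ∉ ys
    s∉ys i = Unique.Unique[x∷xs]⇒x∉xs unique (there (∈-++⁺ʳ a (∈-++⁺ʳ b i)))
    v≢t : v ≢ t
    v≢t refl = Unique.Unique[x∷xs]⇒x∉xs (Unique-++⁻ʳ ⟨ s ⟩ unique)
                 (∈-++⁺ʳ a (∈-++⁺ʳ b t∈ys))
  ... | _ , _ , _ , q∈ , z∈ , p , ue , e∉ = lollipop-next k H ≤k L q∈ z∈ p ue e∉

  biconnected⇒cycle : ∀ {s t} → s ≢ t → Star _~_ s t → Biconnected s t →
                      ∃₂ λ a b → Cycle s a t b
  biconnected⇒cycle s≢t p H with simple-tail p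
  ... | [] , [] , _ = ⊥-elim (s≢t refl)
  -- Start with the first edge of a simple path, taken twice, and the rest of the path as tail.
  ... | v ∷ ys , e ∷ q , u = lollipop⇒cycle (length ys) H ≤-refl record
    { path₁ = edge e ; path₂ = edge e ; tail = q ; unique = u }

  -- From the game tree to Divider's strategies.

  module _ {s t d₀ : V} where

    open Game G s t (d₀ ∷ [])

    -- Facilitator's moves from `Wins` are played against the responses of `σ`; the play follows `σ`
    -- throughout and ends in a meeting.
    wins⇒no-winning-strategy :
      (σ : Strategy) → Winning σ → ∀ {r j d} → Wins r j d → d ≢ r → d ≢ j →
      (h : Play facilitator r j (d ∷ [])) → ¬ Follows σ h
    wins⇒no-winning-strategy σ win meet d≢r d≢j h f = win h f refl
    wins⇒no-winning-strategy σ win {d = d} (move r′ j′ m m′ r′≢d j′≢d next) d≢r d≢j h f =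
      -- The response is generalised to `D`, so that it can be taken apart while the equation still
      -- certifies that the play follows `σ`.
      reply (proj₂ (σ h′)) refl
      where
      step : ∀ {u v} → v ≢ d → Move u v → Step G (d ∷ []) u v
      step v≢d (inj₁ eq) = inj₁ eq
      step v≢d (inj₂ e)  = inj₂ (e , λ { (here v≡d) → v≢d v≡d })

      h′ : Play divider r′ j′ (d ∷ [])
      h′ = fmove h (step r′≢d m) (step j′≢d m′)

      reply : ∀ {D} → Pointwise (Step G (r′ ∷ j′ ∷ [])) (d ∷ []) D → ¬ (D ≡ proj₁ (σ h′))
      reply (_∷_ {y = d′} s []) eq =
        wins⇒no-winning-strategy σ win (next d′ (unstep s) (≢r s) (≢j s))
          (≢r s) (≢j s) (dmove h′ (s ∷ [])) (f , eq)
        where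
        unstep : Step G (r′ ∷ j′ ∷ []) d d′ → Move d d′
        unstep (inj₁ eq)      = inj₁ eq
        unstep (inj₂ (e , _)) = inj₂ e
        ≢r : Step G (r′ ∷ j′ ∷ []) d d′ → d′ ≢ r′
        ≢r (inj₁ refl)       = ≢-sym r′≢d
        ≢r (inj₂ (_ , ∉occ)) = ∉occ ∘ here
        ≢j : Step G (r′ ∷ j′ ∷ []) d d′ → d′ ≢ j′
        ≢j (inj₁ refl)       = ≢-sym j′≢d
        ≢j (inj₂ (_ , ∉occ)) = ∉occ ∘ λ eq → there (here eq)

  -- The two implications.

  adjOutside? : ∀ S → Decidable (AdjOutside G S)
  adjOutside? S u v = ¬? (u ∈ₛ? S) ×-dec ¬? (v ∈ₛ? S) ×-dec u ~? v

  -- A separating vertex is searched for among the finitely many candidates. If none exists,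
  -- decidable reachability gives actual walks around every vertex, hence a cycle on which
  -- Facilitator beats the agent.
  divider⇒cut : ∀ {s t} → Connected G → s ≢ t → DividerWins G s t 1 →
                Σ (Subset n) λ S → ∣ S ∣ ≡ 1 × Separates G s t S
  divider⇒cut {s} {t} conn s≢t (d ∷ [] , (d≢s , d≢t) ∷ [] , σ , win)
    with any? (λ v → ¬? (v ≟ s) ×-dec ¬? (v ≟ t) ×-dec ¬? (star? (adjOutside? ⁅ v ⁆) s t))
  ... | yes (v , v≢s , v≢t , sep) =
    ⁅ v ⁆ , ∣⁅x⁆∣≡1 v , x≢y⇒x∉⁅y⁆ (≢-sym v≢s) , x≢y⇒x∉⁅y⁆ (≢-sym v≢t) , sep
  ... | no none with biconnected⇒cycle s≢t (conn s t) (λ v v≢s v≢t →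
                       decidable-stable (star? (adjOutside? ⁅ v ⁆) s t)
                         λ sep → none (v , v≢s , v≢t , sep))
  ... | _ , _ , c =
    ⊥-elim (wins⇒no-winning-strategy σ win (cycle-wins _ c ≤-refl d≢s d≢t) d≢s d≢t Game.start _)

  -- With the agent fixed on `v`, R stays in the component of `s` and J in that of `t` after removal
  -- of `v`.
  cut⇒divider : ∀ {s t v} → Separates G s t ⁅ v ⁆ → DividerWins G s t 1
  cut⇒divider {s} {t} {v} (s∉ , t∉ , sep) =
    v ∷ [] , (≢-sym (x∉⁅y⁆⇒x≢y s∉) , ≢-sym (x∉⁅y⁆⇒x≢y t∉)) ∷ [] , stay , λ where
      h f refl → let _ , (_ , s⇝r) , (_ , t⇝r) = invariant h f in
        sep (s⇝r ◅◅ Star.reverse (λ (u∉ , v∉ , e) → v∉ , u∉ , ~-sym e) t⇝r)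
    where
    open Game G s t (v ∷ [])

    Reached : V → V → Set
    Reached x u = u Subset.∉ ⁅ v ⁆ × Star (AdjOutside G ⁅ v ⁆) x u

    stay : Strategy
    stay {D = D} _ = D , Pointwise.refl (inj₁ refl)

    step : ∀ {x u w} → Reached x u → Step G (v ∷ []) u w → Reached x w
    step reached    (inj₁ refl)     = reached
    step (u∉ , p) (inj₂ (e , w∉)) = w∉′ , p ◅◅ (u∉ , w∉′ , e) ◅ ε
      where w∉′ = x≢y⇒x∉⁅y⁆ (w∉ ∘ here)

    invariant : ∀ {p r j D} (h : Play p r j D) → Follows stay h →
                D ≡ v ∷ [] × Reached s r × Reached t j
    invariant start _ = refl , (s∉ , ε) , (t∉ , ε)
    invariant (fmove h m m′) f with invariant h f
    ... | refl , s⇝r , t⇝j = refl , step s⇝r m , step t⇝j m′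
    invariant (dmove h _) (f , refl) = invariant h f

  ∅-separates⇒disconnected : ∀ {s t} → Separates G s t Subset.⊥ → ¬ Star _~_ s t
  ∅-separates⇒disconnected (_ , _ , sep) = sep ∘ Star.map (λ e → ∉⊥ , ∉⊥ , e)

theorem2 : ∀ {n : ℕ} (G : Graph n) → Connected G → ∀ (s t : Fin n) → IsDividingNumber G s t [ 1 ] ⇔ IsSeparationNumber G s t [ 1 ]
theorem2 G conn s t = mk⇔ to from
  where
  to : IsDividingNumber G s t [ 1 ] → IsSeparationNumber G s t [ 1 ]
  to (inj₁ (_ , ()))
  to (inj₂ (s≁t , (_ , wins) , _)) =
    inj₂ (s≁t , divider⇒cut G conn (s≁t ∘ inj₁) wins , minimal)
    where
    minimal : ∀ k → Σ _ (λ S → ∣ S ∣ ≡ k × Separates G s t S) → 1 ≤ k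
    minimal (suc k) _ = s≤s z≤n
    -- Connectedness rules out the empty separator.
    minimal zero (S , eq , sep) with ∣p∣≡0⇒p≡⊥ S eq
    ... | refl = ⊥-elim (∅-separates⇒disconnected G sep (conn s t))

  from : IsSeparationNumber G s t [ 1 ] → IsDividingNumber G s t [ 1 ]
  from (inj₁ (_ , ()))
  from (inj₂ (s≁t , (S , eq , sep) , _)) with ∣p∣≡1⇒p≡⁅x⁆ S eq
  ... | _ , refl = inj₂ (s≁t , (≤-refl , cut⇒divider G sep) , λ _ → proj₁)
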